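{- Let $a,b\geq 1$ and $m,n,p,q>1$ be integers. The graph $aH_{m,p}\circ bH_{n,q}$ is distance magic if and only if $n\equiv 0\pmod 2$ or $mnabpq\equiv 1\pmod 2$.
   Context: A graph $G$ on $v$ vertices is distance magic if there is a bijection $f:V(G)\to\{1,\ldots,v\}$ and a constant $k$ such that for every vertex $x$, $\sum_{y\in N(x)}f(y)=k$, where $N(x)$ is the set of neighbours of $x$. $H_{n,p}$ denotes the complete multipartite graph with $p$ partite sets each of size $n$; $aH$ denotes the disjoint union of $a$ copies of $H$. The lexicographic product $G\circ H$ has vertex set $V(G)\times V(H)$, with $(g,h)$ adjacent to $(g',h')$ iff either $gg'\in E(G)$, or $g=g'$ and $hh'\in E(H)$. -}

module Defs where

open import Data.Fin using (Fin; toℕ)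
open import Data.Fin.Properties using (_≟_; *↔×)
open import Data.List using (List; allFin; filter; map)
open import Data.Nat using (ℕ; suc; _*_)
open import Data.Nat.ListAction using (sum)
open import Data.Product using (_×_; _,_; proj₁; Σ-syntax; ∃-syntax)
open import Data.Product.Function.NonDependent.Propositional using (_×-↔_)
open import Data.Sum using (_⊎_; inj₁; inj₂)
open import Function using (_⤖_; _↔_; module Inverse; module Bijection)
open import Function.Construct.Identity using (↔-id)
open import Function.Properties.Inverse using (↔-sym; ↔-trans; ↔⇒↣)
open import Level using (0ℓ)
open import Relation.Binary using (Rel; Decidable; DecidableEquality; Symmetric; Irreflexive)
open import Relation.Binary.PropositionalEquality using (_≡_; refl; sym; ≢-sym)
open import Relation.Nullary.Decidable using (¬?; _×-dec_; _⊎-dec_; via-injection)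
open import Relation.Nullary.Negation using (¬_)

record Graph : Set₁ where
  field
    Vertex      : Set
    order       : ℕ
    enumeration : Fin order ↔ Vertex
    Adj         : Rel Vertex 0ℓ
    adj?        : Decidable Adj
    adj-sym     : Symmetric Adj
    adj-irrefl  : Irreflexive _≡_ Adj

  vertices : List Vertex
  vertices = map (Inverse.to enumeration) (allFin order)

  _≟ᵛ_ : DecidableEquality Vertex
  _≟ᵛ_ = via-injection (↔⇒↣ (↔-sym enumeration)) _≟_

  -- Each neighbour occurs exactly once, because enumeration is a bijection.
  neighbours : Vertex → List Vertex
  neighbours x = filter (adj? x) vertices

open Graph

-- i : Fin v stands for the label suc (toℕ i) in {1, …, v}.
label : (G : Graph) → Vertex G ⤖ Fin (order G) → Vertex G → ℕ
label G f x = suc (toℕ (Bijection.to f x))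

DistanceMagic : Graph → Set
DistanceMagic G =
  Σ[ f ∈ Vertex G ⤖ Fin (order G) ] ∃[ k ]
    (∀ x → sum (map (label G f) (neighbours G x)) ≡ k)

-- H n p has p partite sets, each of size n; the first component of a vertex
-- is the index of its partite set.
H : ℕ → ℕ → Graph
H n p = record
  { Vertex      = Fin p × Fin n
  ; order       = p * n
  ; enumeration = *↔×
  ; Adj         = λ x y → ¬ (proj₁ x ≡ proj₁ y)
  ; adj?        = λ x y → ¬? (proj₁ x ≟ proj₁ y)
  ; adj-sym     = ≢-sym
  ; adj-irrefl  = λ { refl i≢i → i≢i refl }
  }

infixr 8 _·_
infixl 7 _⊚_

-- Disjoint union of a copies of G.
_·_ : ℕ → Graph → Graph
a · G = record
  { Vertex      = Fin a × Vertex G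
  ; order       = a * order G
  ; enumeration = ↔-trans *↔× (↔-id (Fin a) ×-↔ enumeration G)
  ; Adj         = λ (i , x) (j , y) → i ≡ j × Adj G x y
  ; adj?        = λ (i , x) (j , y) → (i ≟ j) ×-dec adj? G x y
  ; adj-sym     = λ { (i≡j , xy) → sym i≡j , adj-sym G xy }
  ; adj-irrefl  = λ { refl (_ , xx) → adj-irrefl G refl xx }
  }

-- Lexicographic product, written ∘ in the literature; _∘_ is kept for functions.
_⊚_ : Graph → Graph → Graph
G ⊚ K = record
  { Vertex      = Vertex G × Vertex K
  ; order       = order G * order K
  ; enumeration = ↔-trans *↔× (enumeration G ×-↔ enumeration K)
  ; Adj         = λ (g , h) (g′ , h′) → Adj G g g′ ⊎ (g ≡ g′ × Adj K h h′)
  ; adj?        = λ (g , h) (g′ , h′) → adj? G g g′ ⊎-dec (_≟ᵛ_ G g g′ ×-dec adj? K h h′)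
  ; adj-sym     = λ { (inj₁ gg′)          → inj₁ (adj-sym G gg′)
                    ; (inj₂ (g≡g′ , hh′)) → inj₂ (sym g≡g′ , adj-sym K hh′) }
  ; adj-irrefl  = λ { refl (inj₁ gg)       → adj-irrefl G refl gg
                    ; refl (inj₂ (_ , hh)) → adj-irrefl K refl hh }
  }

{-# OPTIONS --safe #-}
module Submission where

-- Call the labels of the n vertices of one partite set of one copy of H n q inside
-- one fibre of the product a block. Comparing the weights of suitable vertices, and
-- cancelling, shows that a labelling is magic iff all blocks have the same sum c.
-- With r = a p m b q blocks and N = r n labels, summing everything gives
-- 2 c = n (N + 1), so n is even or N is odd. Conversely, label the w-th vertex of
-- block x by r w + π_w(x) + 1, where the permutations π_w of {0, …, r − 1} have
-- constant pointwise sum: pairs of rows x, r − 1 − x suffice for even n, and one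
-- extra triple of rows exists when r is odd.

open import Defs
open import Data.Bool using (Bool; true; false; if_then_else_; _∧_; _∨_; not)
open import Data.Empty using (⊥-elim)
open import Data.Fin using (Fin; zero; suc; toℕ; fromℕ<; _↑ˡ_; _↑ʳ_; combine; remQuot; punchOut)
open import Data.Fin.Permutation using (Permutation′; permutation; reverse; cast-id; _⟨$⟩ʳ_; _⟨$⟩ˡ_)
import Data.Fin.Permutation as Perm
import Data.Fin.Properties as Fin
open import Data.List using ([]; _∷_; allFin; filter; map; tabulate)
import Data.List.Properties as List
open import Data.Nat using (ℕ; zero; suc; _+_; _*_; _∸_; _≤_; _<_; _≥_; _>_; _%_; _/_; s≤s; z<s; _≤?_; NonZero; >-nonZero)
open import Data.Nat.Divisibility using (divides; n∣m⇒m%n≡0; m%n≡0⇒n∣m; ∣m⇒∣m*n)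
open import Data.Nat.DivMod using (m≡m%n+[m/n]*n; m%n<n; %-pred-≡0)
import Data.Nat.ListAction as List
open import Data.Nat.Primality using (prime[2]; euclidsLemma)
open import Data.Nat.Properties
open import Data.Nat.Tactic.RingSolver using (solve-∀)
open import Data.Product using (_×_; _,_; proj₁; proj₂; Σ-syntax; ∃-syntax)
open import Data.Product.Function.NonDependent.Propositional using (_×-↔_)
open import Data.Sum using (_⊎_; inj₁; inj₂)
import Data.Sum as Sum
import Data.Vec.Functional as Vector
open import Function using (_∘_; _⤖_; _↔_; mk↔ₛ′; module Inverse; Injective)
open import Function.Bundles using (_⇔_; mk⇔)
open import Function.Properties.Bijection using (⤖⇒↔)
open import Function.Properties.Inverse using (↔-sym; ↔-trans; ↔⇒⤖)
open import Level using (0ℓ)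
open import Relation.Binary.PropositionalEquality using (_≡_; _≗_; refl; sym; trans; cong; cong₂; subst; module ≡-Reasoning)
open import Relation.Nullary using (Dec; yes; no; does; ¬_; contradiction)
open import Relation.Nullary.Decidable using (dec-true; dec-false)
open import Relation.Unary using (Pred; Decidable)

open import Algebra.Properties.Semiring.Sum +-*-semiring using (sum; sum-syntax; sum-cong-≗; ∑-distrib-+; ∑-permute; sum-replicate-zero)

open Graph
open ≡-Reasoning

-- Finite sums

sum-const : ∀ n c → ∑[ i < n ] c ≡ n * c
sum-const zero    c = refl
sum-const (suc n) c = cong (c +_) (sum-const n c)

sum-uniform : ∀ {n c} {f : Fin n → ℕ} → (∀ i → f i ≡ c) → sum f ≡ n * c
sum-uniform {n} {c} f≡c = trans (sum-cong-≗ f≡c) (sum-const n c)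

sum-++ : ∀ m {n} (f : Fin (m + n) → ℕ) → sum f ≡ ∑[ i < m ] f (i ↑ˡ n) + ∑[ j < n ] f (m ↑ʳ j)
sum-++ zero    f = refl
sum-++ (suc m) f = trans (cong (f zero +_) (sum-++ m (f ∘ suc))) (sym (+-assoc (f zero) _ _))

sum-combine : ∀ m {n} (f : Fin (m * n) → ℕ) → sum f ≡ ∑[ i < m ] ∑[ j < n ] f (combine i j)
sum-combine zero        f = refl
sum-combine (suc m) {n} f = trans (sum-++ n f) (cong₂ _+_ refl (sum-combine m (f ∘ (n ↑ʳ_))))

sum-remQuot : ∀ m {n} (f : Fin m × Fin n → ℕ) → ∑[ k < m * n ] f (remQuot n k) ≡ ∑[ i < m ] ∑[ j < n ] f (i , j)
sum-remQuot m f = trans (sum-combine m _)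
  (sum-cong-≗ λ i → sum-cong-≗ λ j → cong f (Fin.remQuot-combine i j))

-- The indicator is a bare Boolean function, so that `does` of any decision procedure fits, both for
-- `Fin` and for vertices of a graph.
sum-delta : ∀ {n} (b : Fin n → Bool) (f : Fin n → ℕ) k → b k ≡ true → (∀ i → b i ≡ true → i ≡ k) →
  ∑[ i < n ] (if b i then f i else 0) ≡ f k
sum-delta {suc n} b f zero bk unique rewrite bk = trans (cong (f zero +_) (trans (sum-cong-≗ vanish) (sum-replicate-zero n))) (+-identityʳ _)
  where
  vanish : ∀ i → (if b (suc i) then f (suc i) else 0) ≡ 0
  vanish i with b (suc i) in eq
  ... | false = refl
  ... | true  with () ← unique (suc i) eq
sum-delta {suc n} b f (suc k) bk unique with b zero in eq
... | true  with () ← unique zero eq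
... | false = sum-delta (b ∘ suc) (f ∘ suc) k bk λ i bi → Fin.suc-injective (unique (suc i) bi)

2*sum-suc∘toℕ : ∀ n → 2 * ∑[ i < n ] suc (toℕ i) ≡ n * suc n
2*sum-suc∘toℕ zero    = refl
2*sum-suc∘toℕ (suc n) = begin
  2 * (1 + ∑[ i < n ] (1 + suc (toℕ i)))     ≡⟨ cong (λ s → 2 * (1 + s)) (trans (∑-distrib-+ {n} (λ _ → 1) (suc ∘ toℕ)) (cong₂ _+_ (sum-const n 1) refl)) ⟩
  2 * (1 + (n * 1 + ∑[ i < n ] suc (toℕ i))) ≡⟨ expand n _ ⟩
  2 + 2 * n + 2 * ∑[ i < n ] suc (toℕ i)     ≡⟨ cong (2 + 2 * n +_) (2*sum-suc∘toℕ n) ⟩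
  2 + 2 * n + n * suc n                      ≡⟨ collect n ⟩
  suc n * suc (suc n)                        ∎
  where
  expand : ∀ n s → 2 * (1 + (n * 1 + s)) ≡ 2 + 2 * n + 2 * s
  expand = solve-∀
  collect : ∀ n → 2 + 2 * n + n * suc n ≡ suc n * suc (suc n)
  collect = solve-∀

-- Sums over the vertices and over the neighbours of a vertex

∑ᵛ : (G : Graph) → (Vertex G → ℕ) → ℕ
∑ᵛ G φ = ∑[ i < order G ] φ (Inverse.to (enumeration G) i)

∑ᵛ-cong : ∀ G {φ ψ : Vertex G → ℕ} → φ ≗ ψ → ∑ᵛ G φ ≡ ∑ᵛ G ψ
∑ᵛ-cong G φ≗ψ = sum-cong-≗ {order G} (φ≗ψ ∘ Inverse.to (enumeration G))

∑ᵛ-H : ∀ n p φ → ∑ᵛ (H n p) φ ≡ ∑[ s < p ] ∑[ t < n ] φ (s , t)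
∑ᵛ-H n p φ = sum-remQuot p φ

∑ᵛ-· : ∀ a G φ → ∑ᵛ (a · G) φ ≡ ∑[ i < a ] ∑ᵛ G (λ x → φ (i , x))
∑ᵛ-· a G φ = sum-remQuot a {order G} λ (i , k) → φ (i , Inverse.to (enumeration G) k)

∑ᵛ-⊚ : ∀ G K φ → ∑ᵛ (G ⊚ K) φ ≡ ∑ᵛ G (λ g → ∑ᵛ K (λ h → φ (g , h)))
∑ᵛ-⊚ G K φ = sum-remQuot (order G) {order K} λ (i , k) → φ (Inverse.to (enumeration G) i , Inverse.to (enumeration K) k)

does-true : ∀ {A : Set} (A? : Dec A) → does A? ≡ true → A
does-true (yes x) _ = x

∑ᵛ-delta : ∀ G (φ : Vertex G → ℕ) x → ∑ᵛ G (λ y → if does (_≟ᵛ_ G x y) then φ y else 0) ≡ φ x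
∑ᵛ-delta G φ x = trans
  (sum-delta (λ k → does (_≟ᵛ_ G x (to k))) (φ ∘ to) (from x)
    (dec-true (_≟ᵛ_ G x (to (from x))) (sym to-from))
    unique)
  (cong φ to-from)
  where
  open Inverse (enumeration G) using (to; from; inverseˡ; inverseʳ)
  to-from : to (from x) ≡ x
  to-from = inverseˡ refl
  unique : ∀ k → does (_≟ᵛ_ G x (to k)) ≡ true → k ≡ from x
  unique k eq = trans (sym (inverseʳ refl)) (cong from (sym (does-true (_≟ᵛ_ G x (to k)) eq)))

∑ᴺ : (G : Graph) → (Vertex G → ℕ) → Vertex G → ℕ
∑ᴺ G φ x = List.sum (map φ (neighbours G x))

sum-map-tabulate : ∀ {A : Set} (φ : A → ℕ) {n} (f : Fin n → A) → List.sum (map φ (tabulate f)) ≡ ∑[ i < n ] φ (f i)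
sum-map-tabulate φ {zero}  f = refl
sum-map-tabulate φ {suc n} f = cong (φ (f zero) +_) (sum-map-tabulate φ (f ∘ suc))

sum-map-filter : ∀ {A : Set} {P : Pred A 0ℓ} (P? : Decidable P) (φ : A → ℕ) xs →
  List.sum (map φ (filter P? xs)) ≡ List.sum (map (λ x → if does (P? x) then φ x else 0) xs)
sum-map-filter P? φ []       = refl
sum-map-filter P? φ (x ∷ xs) with does (P? x)
... | true  = cong (φ x +_) (sum-map-filter P? φ xs)
... | false = sum-map-filter P? φ xs

restrict : (G : Graph) → (Vertex G → ℕ) → Vertex G → Vertex G → ℕ
restrict G φ x y = if does (adj? G x y) then φ y else 0

∑ᴺ≡∑ᵛ : ∀ G φ x → ∑ᴺ G φ x ≡ ∑ᵛ G (restrict G φ x)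
∑ᴺ≡∑ᵛ G φ x = begin
  List.sum (map φ (filter (adj? G x) (vertices G)))    ≡⟨ sum-map-filter (adj? G x) φ (vertices G) ⟩
  List.sum (map (restrict G φ x) (map to (allFin (order G))))         ≡⟨ cong (List.sum ∘ map (restrict G φ x)) (List.map-tabulate (λ i → i) to) ⟩
  List.sum (map (restrict G φ x) (tabulate to))                       ≡⟨ sum-map-tabulate (restrict G φ x) to ⟩
  ∑ᵛ G (restrict G φ x)                                               ∎
  where
  open Inverse (enumeration G) using (to)

if-split : ∀ b m → (if not b then m else 0) + (if b then m else 0) ≡ m
if-split true  m = refl
if-split false m = +-identityʳ m

sum-≟ : ∀ {n} (f : Fin n → ℕ) i → ∑[ j < n ] (if does (i Fin.≟ j) then f j else 0) ≡ f i
sum-≟ f i = sum-delta (λ j → does (i Fin.≟ j)) f i (dec-true (i Fin.≟ i) refl) λ j eq → sym (does-true (i Fin.≟ j) eq)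

sum-if : ∀ b {n} (f : Fin n → ℕ) → ∑[ i < n ] (if b then f i else 0) ≡ (if b then sum f else 0)
sum-if true      f = refl
sum-if false {n} f = sum-replicate-zero n

-- The non-neighbours of `(s , t)` are exactly part `s`; adding that part back avoids truncated
-- subtraction.
∑ᴺ-H : ∀ n p φ s t → ∑ᴺ (H n p) φ (s , t) + ∑[ j < n ] φ (s , j) ≡ ∑[ i < p ] ∑[ j < n ] φ (i , j)
∑ᴺ-H n p φ s t = begin
  ∑ᴺ (H n p) φ (s , t) + part s
    ≡⟨ cong₂ _+_ (trans (∑ᴺ≡∑ᵛ (H n p) φ (s , t)) (∑ᵛ-H n p (restrict (H n p) φ (s , t)))) (sym (sum-≟ part s)) ⟩
  (∑[ i < p ] ∑[ j < n ] (if not (does (s Fin.≟ i)) then φ (i , j) else 0)) + (∑[ i < p ] (if does (s Fin.≟ i) then part i else 0))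
    ≡⟨ cong₂ _+_ (sum-cong-≗ λ i → sum-if (not (does (s Fin.≟ i))) (λ j → φ (i , j))) refl ⟩
  (∑[ i < p ] (if not (does (s Fin.≟ i)) then part i else 0)) + (∑[ i < p ] (if does (s Fin.≟ i) then part i else 0))
    ≡⟨ ∑-distrib-+ {p} _ _ ⟨
  ∑[ i < p ] ((if not (does (s Fin.≟ i)) then part i else 0) + (if does (s Fin.≟ i) then part i else 0))
    ≡⟨ sum-cong-≗ (λ i → if-split (does (s Fin.≟ i)) (part i)) ⟩
  sum part ∎
  where
  part : Fin p → ℕ
  part i = ∑[ j < n ] φ (i , j)

if-∧ : ∀ b c (m : ℕ) → (if b ∧ c then m else 0) ≡ (if b then (if c then m else 0) else 0)
if-∧ true  c m = refl
if-∧ false c m = refl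

∑ᴺ-· : ∀ a G φ i x → ∑ᴺ (a · G) φ (i , x) ≡ ∑ᴺ G (λ y → φ (i , y)) x
∑ᴺ-· a G φ i x = begin
  ∑ᴺ (a · G) φ (i , x)
    ≡⟨ trans (∑ᴺ≡∑ᵛ (a · G) φ (i , x)) (∑ᵛ-· a G (restrict (a · G) φ (i , x))) ⟩
  ∑[ j < a ] ∑ᵛ G (λ y → if does (i Fin.≟ j) ∧ does (adj? G x y) then φ (j , y) else 0)
    ≡⟨ sum-cong-≗ (λ j → trans (∑ᵛ-cong G λ y → if-∧ (does (i Fin.≟ j)) (does (adj? G x y)) (φ (j , y))) (sum-if (does (i Fin.≟ j)) {order G} _)) ⟩
  ∑[ j < a ] (if does (i Fin.≟ j) then ∑ᵛ G (restrict G (λ y → φ (j , y)) x) else 0)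
    ≡⟨ sum-≟ (λ j → ∑ᵛ G (restrict G (λ y → φ (j , y)) x)) i ⟩
  ∑ᵛ G (restrict G (λ y → φ (i , y)) x)
    ≡⟨ ∑ᴺ≡∑ᵛ G _ x ⟨
  ∑ᴺ G (λ y → φ (i , y)) x ∎

if-∨ : ∀ b c d (m : ℕ) → (b ≡ true → c ≡ false) →
  (if b ∨ (c ∧ d) then m else 0) ≡ (if b then m else 0) + (if c then (if d then m else 0) else 0)
if-∨ true  c d m disjoint rewrite disjoint refl = sym (+-identityʳ m)
if-∨ false c d m disjoint = if-∧ c d m

-- A vertex over `g` sees the whole fibres over the neighbours of `g` and its own neighbours in its
-- own fibre. Irreflexivity of `G` makes the two cases exclusive, so the indicator of the
-- disjunction is a sum.
∑ᴺ-⊚ : ∀ G K φ g h → ∑ᴺ (G ⊚ K) φ (g , h) ≡ ∑ᴺ G (λ g′ → ∑ᵛ K (λ h′ → φ (g′ , h′))) g + ∑ᴺ K (λ h′ → φ (g , h′)) h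
∑ᴺ-⊚ G K φ g h = begin
  ∑ᴺ (G ⊚ K) φ (g , h)
    ≡⟨ trans (∑ᴺ≡∑ᵛ (G ⊚ K) φ (g , h)) (∑ᵛ-⊚ G K (restrict (G ⊚ K) φ (g , h))) ⟩
  ∑ᵛ G (λ g′ → ∑ᵛ K (λ h′ → if adj g′ ∨ (eq g′ ∧ does (adj? K h h′)) then φ (g′ , h′) else 0))
    ≡⟨ ∑ᵛ-cong G (λ g′ → trans (∑ᵛ-cong K λ h′ → if-∨ (adj g′) (eq g′) (does (adj? K h h′)) (φ (g′ , h′)) (disjoint g′))
         (trans (∑-distrib-+ {order K} (λ k → if adj g′ then φ (g′ , toK k) else 0) (λ k → if eq g′ then restrict K (λ h′ → φ (g′ , h′)) h (toK k) else 0))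
           (cong₂ _+_ (sum-if (adj g′) {order K} (λ k → φ (g′ , toK k))) (sum-if (eq g′) {order K} (λ k → restrict K (λ h′ → φ (g′ , h′)) h (toK k)))))) ⟩
  ∑ᵛ G (λ g′ → (if adj g′ then total g′ else 0) + (if eq g′ then inner g′ else 0))
    ≡⟨ ∑-distrib-+ {order G} _ _ ⟩
  ∑ᵛ G (λ g′ → if adj g′ then total g′ else 0) + ∑ᵛ G (λ g′ → if eq g′ then inner g′ else 0)
    ≡⟨ cong₂ _+_ (sym (∑ᴺ≡∑ᵛ G total g)) (trans (∑ᵛ-delta G inner g) (sym (∑ᴺ≡∑ᵛ K _ h))) ⟩
  ∑ᴺ G total g + ∑ᴺ K (λ h′ → φ (g , h′)) h ∎
  where
  toK : Fin (order K) → Vertex K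
  toK = Inverse.to (enumeration K)
  adj eq : Vertex G → Bool
  adj g′ = does (adj? G g g′)
  eq g′ = does (_≟ᵛ_ G g g′)
  total inner : Vertex G → ℕ
  total g′ = ∑ᵛ K (λ h′ → φ (g′ , h′))
  inner g′ = ∑ᵛ K (restrict K (λ h′ → φ (g′ , h′)) h)
  disjoint : ∀ g′ → adj g′ ≡ true → eq g′ ≡ false
  disjoint g′ adjacent = dec-false (_≟ᵛ_ G g g′) λ g≡g′ → adj-irrefl G g≡g′ (does-true (adj? G g g′) adjacent)

-- Kotzig arrays: rows permuting 0, ..., r - 1, with constant column sums

record KotzigArray (n r : ℕ) : Set where
  field
    row        : Fin n → Permutation′ r
    constant   : ℕ
    column-sum : ∀ c → ∑[ w < n ] toℕ (row w ⟨$⟩ʳ c) ≡ constant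

open KotzigArray

toℕ-reverse : ∀ {r} (c : Fin r) → toℕ c + toℕ (reverse ⟨$⟩ʳ c) ≡ r ∸ 1
toℕ-reverse {suc r} c = trans (cong (toℕ c +_) (Fin.opposite-prop c)) (m+[n∸m]≡n (Fin.toℕ≤pred[n] c))

empty : ∀ {r} → KotzigArray 0 r
empty = record { row = λ () ; constant = 0 ; column-sum = λ _ → refl }

-- The identity and the reversal together add r - 1 to every column.
addPair : ∀ {n r} → KotzigArray n r → KotzigArray (2 + n) r
addPair {n} {r} A = record
  { row        = Perm.id Vector.∷ reverse Vector.∷ row A
  ; constant   = r ∸ 1 + constant A
  ; column-sum = λ c → trans (sym (+-assoc (toℕ c) _ _)) (cong₂ _+_ (toℕ-reverse c) (column-sum A c))
  }

addPairs : ∀ {n r} k → KotzigArray n r → KotzigArray (k * 2 + n) r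
addPairs zero    A = A
addPairs (suc k) A = addPair (addPairs k A)

-- A missed value `y` could be punched out of the codomain, leaving an injection from `suc n`
-- elements into `n`. This yields permutations without explicit inverses such as halving modulo an
-- odd number.
injective⇒surjective : ∀ {n} {f : Fin n → Fin n} → Injective _≡_ _≡_ f → ∀ y → ∃[ x ] f x ≡ y
injective⇒surjective {suc n} {f} f-injective y with Fin.any? (λ x → f x Fin.≟ y)
... | yes ∃x = ∃x
... | no ∄x = contradiction
  (Fin.injective⇒≤ {f = λ x → punchOut (y≢f x)} λ {x} {x′} eq → f-injective (Fin.punchOut-injective (y≢f x) (y≢f x′) eq))
  1+n≰n
  where
  y≢f : ∀ x → ¬ y ≡ f x
  y≢f x y≡fx = ∄x (x , sym y≡fx)

injective⇒permutation : ∀ {n} (f : Fin n → Fin n) → Injective _≡_ _≡_ f → Permutation′ n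
injective⇒permutation f f-injective = permutation f (proj₁ ∘ inverse) (proj₂ ∘ inverse)
  (λ x → f-injective (proj₂ (inverse (f x))))
  where inverse = injective⇒surjective f-injective

-- The maps c ↦ 2c and c ↦ h − c are permutations of ℤ/(2h + 1), and on
-- representatives both wrap around exactly when c > h; together with c ↦ 2h − c
-- they sum to 3h.
module ThreeRows (h : ℕ) where

  R : ℕ
  R = suc (2 * h)

  -- Congruence modulo `R` with its only two possible wraps spelled out additively. Injectivity of
  -- both rows follows from these relations alone.
  Doubled : Fin R → Fin R → Set
  Doubled c d = toℕ d ≡ 2 * toℕ c ⊎ toℕ d + R ≡ 2 * toℕ c

  Reflected : Fin R → Fin R → Set
  Reflected c e = toℕ e + toℕ c ≡ h ⊎ toℕ e + toℕ c ≡ h + R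

  images : ∀ c → Σ[ d ∈ Fin R ] Σ[ e ∈ Fin R ]
    Doubled c d × Reflected c e × toℕ d + toℕ e ≡ h + toℕ c
  images c with toℕ c ≤? h
  ... | yes c≤h = fromℕ< d<R , fromℕ< e<R , inj₁ d≡ , inj₁ e≡ , (begin
    toℕ (fromℕ< d<R) + toℕ (fromℕ< e<R) ≡⟨ cong (_+ toℕ (fromℕ< e<R)) d≡ ⟩
    2 * toℕ c + toℕ (fromℕ< e<R)        ≡⟨ regroup (toℕ c) (toℕ (fromℕ< e<R)) ⟩
    toℕ (fromℕ< e<R) + toℕ c + toℕ c    ≡⟨ cong (_+ toℕ c) e≡ ⟩
    h + toℕ c                           ∎)
    where
    d<R : 2 * toℕ c < R
    d<R = s≤s (*-monoʳ-≤ 2 c≤h)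
    e<R : h ∸ toℕ c < R
    e<R = s≤s (≤-trans (m∸n≤m h (toℕ c)) (m≤m+n h _))
    d≡ : toℕ (fromℕ< d<R) ≡ 2 * toℕ c
    d≡ = Fin.toℕ-fromℕ< d<R
    e≡ : toℕ (fromℕ< e<R) + toℕ c ≡ h
    e≡ = trans (cong (_+ toℕ c) (Fin.toℕ-fromℕ< e<R)) (m∸n+n≡m c≤h)
    regroup : ∀ x y → 2 * x + y ≡ y + x + x
    regroup = solve-∀
  -- Both rows wrap: `d` loses `R` and `e` gains `R`, so their sum is the same as in the unwrapped
  -- case.
  ... | no c≰h = fromℕ< d<R , fromℕ< e<R , inj₂ d≡ , inj₂ e≡ , +-cancelʳ-≡ (R + toℕ c) _ _ (begin
    d + e + (R + toℕ c)           ≡⟨ regroup d e R (toℕ c) ⟩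
    (d + R) + (e + toℕ c)         ≡⟨ cong₂ _+_ d≡ e≡ ⟩
    2 * toℕ c + (h + R)           ≡⟨ regroup′ (toℕ c) h R ⟩
    h + toℕ c + (R + toℕ c)       ∎)
    where
    R≤2c : R ≤ 2 * toℕ c
    R≤2c = ≤-trans (n≤1+n R) (≤-trans (≤-reflexive (sym (*-suc 2 h))) (*-monoʳ-≤ 2 (≰⇒> c≰h)))
    c≤R : toℕ c ≤ R
    c≤R = <⇒≤ (Fin.toℕ<n c)
    d<R : 2 * toℕ c ∸ R < R
    d<R = +-cancelʳ-< R _ _ (subst (_< R + R) (sym (m∸n+n≡m R≤2c))
      (subst (λ s → 2 * toℕ c < R + s) (+-identityʳ R) (*-monoʳ-< 2 (Fin.toℕ<n c))))
    e<R : h + R ∸ toℕ c < R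
    e<R = +-cancelʳ-< (toℕ c) _ _ (subst (_< R + toℕ c) (sym (m∸n+n≡m (≤-trans c≤R (m≤n+m R h))))
      (subst (_< R + toℕ c) (+-comm R h) (+-monoʳ-< R (≰⇒> c≰h))))
    d e : ℕ
    d = toℕ (fromℕ< d<R)
    e = toℕ (fromℕ< e<R)
    d≡ : d + R ≡ 2 * toℕ c
    d≡ = trans (cong (_+ R) (Fin.toℕ-fromℕ< d<R)) (m∸n+n≡m R≤2c)
    e≡ : e + toℕ c ≡ h + R
    e≡ = trans (cong (_+ toℕ c) (Fin.toℕ-fromℕ< e<R)) (m∸n+n≡m (≤-trans c≤R (m≤n+m R h)))
    regroup : ∀ w x y z → w + x + (y + z) ≡ (w + y) + (x + z)
    regroup = solve-∀
    regroup′ : ∀ x y z → 2 * x + (y + z) ≡ y + x + (z + x)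
    regroup′ = solve-∀

  -- Since `R` is odd, `d` and `d + R` cannot both be even.
  doubled-unwrapped : ∀ {c c′ d : Fin R} → toℕ d ≡ 2 * toℕ c → ¬ toℕ d + R ≡ 2 * toℕ c′
  doubled-unwrapped {c} {c′} d≡2c d+R≡2c′ = even≢odd (toℕ c′) (toℕ c + h) (begin
    2 * toℕ c′           ≡⟨ trans (cong (_+ R) (sym d≡2c)) d+R≡2c′ ⟨
    2 * toℕ c + R        ≡⟨ +-suc _ _ ⟩
    suc (2 * toℕ c + 2 * h) ≡⟨ cong suc (*-distribˡ-+ 2 (toℕ c) h) ⟨
    suc (2 * (toℕ c + h)) ∎)

  doubled-injective : ∀ {c c′ d} → Doubled c d → Doubled c′ d → c ≡ c′
  doubled-injective (inj₁ x) (inj₁ y) = Fin.toℕ-injective (*-cancelˡ-≡ _ _ 2 (trans (sym x) y))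
  doubled-injective {c} {c′} {d} (inj₁ x) (inj₂ y) = ⊥-elim (doubled-unwrapped {c} {c′} {d} x y)
  doubled-injective {c} {c′} {d} (inj₂ x) (inj₁ y) = ⊥-elim (doubled-unwrapped {c′} {c} {d} y x)
  doubled-injective (inj₂ x) (inj₂ y) = Fin.toℕ-injective (*-cancelˡ-≡ _ _ 2 (trans (sym x) y))

  -- Otherwise `c′` would be `c + R`, which is out of range.
  reflected-unwrapped : ∀ {c c′ e : Fin R} → toℕ e + toℕ c ≡ h → ¬ toℕ e + toℕ c′ ≡ h + R
  reflected-unwrapped {c} {c′} {e} e+c≡h e+c′≡h+R =
    <⇒≱ (Fin.toℕ<n c′) (≤-trans (m≤n+m R (toℕ c)) (≤-reflexive (sym c′≡c+R)))
    where
    c′≡c+R : toℕ c′ ≡ toℕ c + R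
    c′≡c+R = +-cancelˡ-≡ (toℕ e) _ _ (trans e+c′≡h+R (trans (cong (_+ R) (sym e+c≡h)) (+-assoc (toℕ e) _ _)))

  reflected-injective : ∀ {c c′ e} → Reflected c e → Reflected c′ e → c ≡ c′
  reflected-injective {e = e} (inj₁ x) (inj₁ y) = Fin.toℕ-injective (+-cancelˡ-≡ (toℕ e) _ _ (trans x (sym y)))
  reflected-injective {c} {c′} {e} (inj₁ x) (inj₂ y) = ⊥-elim (reflected-unwrapped {c} {c′} {e} x y)
  reflected-injective {c} {c′} {e} (inj₂ x) (inj₁ y) = ⊥-elim (reflected-unwrapped {c′} {c} {e} y x)
  reflected-injective {e = e} (inj₂ x) (inj₂ y) = Fin.toℕ-injective (+-cancelˡ-≡ (toℕ e) _ _ (trans x (sym y)))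

  double reflect : Permutation′ R
  double = injective⇒permutation (proj₁ ∘ images) λ {c} {c′} eq →
    doubled-injective (proj₁ (proj₂ (proj₂ (images c))))
      (subst (Doubled c′) (sym eq) (proj₁ (proj₂ (proj₂ (images c′)))))
  reflect = injective⇒permutation (proj₁ ∘ proj₂ ∘ images) λ {c} {c′} eq →
    reflected-injective (proj₁ (proj₂ (proj₂ (proj₂ (images c)))))
      (subst (Reflected c′) (sym eq) (proj₁ (proj₂ (proj₂ (proj₂ (images c′))))))

  threeRows : KotzigArray 3 R
  threeRows = record
    { row        = double Vector.∷ reflect Vector.∷ reverse Vector.∷ Vector.[]
    ; constant   = h + 2 * h
    ; column-sum = λ c → let d , e , _ , _ , d+e≡h+c = images c; o = toℕ (reverse ⟨$⟩ʳ c) in begin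
        toℕ d + (toℕ e + (o + 0)) ≡⟨ cong (λ s → toℕ d + (toℕ e + s)) (+-identityʳ o) ⟩
        toℕ d + (toℕ e + o)       ≡⟨ +-assoc (toℕ d) _ _ ⟨
        toℕ d + toℕ e + o         ≡⟨ cong (_+ o) d+e≡h+c ⟩
        h + toℕ c + o             ≡⟨ +-assoc h _ _ ⟩
        h + (toℕ c + o)           ≡⟨ cong (h +_) (toℕ-reverse c) ⟩
        h + 2 * h                 ∎
    }

-- Labellings with equal block sums

blockSum : ∀ {X : Set} {b q n} → (X × Fin b × Fin q × Fin n → ℕ) → X → Fin b → Fin q → ℕ
blockSum {n = n} φ x j u = ∑[ w < n ] φ (x , j , u , w)

EqualBlockSums : (G : Graph) (b n q : ℕ) → Set
EqualBlockSums G b n q =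
  Σ[ f ∈ Vertex (G ⊚ (b · H n q)) ⤖ Fin (order (G ⊚ (b · H n q))) ] ∃[ c ]
    (∀ x j u → blockSum (label (G ⊚ (b · H n q)) f) x j u ≡ c)

-- Columns of the array stand for blocks and rows for positions inside a block. A label less one has
-- the row as its quotient by `r` and the array entry as its remainder, hence bijectivity.
kotzig⇒equalBlockSums : ∀ G b n q → KotzigArray n (order G * (b * q)) → EqualBlockSums G b n q
kotzig⇒equalBlockSums G b n q A = ↔⇒⤖ labelling , ∑[ w < n ] suc (r * toℕ w) + constant A , block
  where
  r : ℕ
  r = order G * (b * q)

  columns : (Vertex G × Fin b × Fin q) ↔ Fin r
  columns = ↔-trans (↔-sym (enumeration G) ×-↔ ↔-sym Fin.*↔×) (↔-sym Fin.*↔×)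

  cells : Vertex (G ⊚ (b · H n q)) ↔ (Fin n × Fin r)
  cells = mk↔ₛ′
    (λ (x , j , u , w) → w , Inverse.to columns (x , j , u))
    (λ (w , c) → let x , j , u = Inverse.from columns c in x , j , u , w)
    (λ (w , c) → cong (w ,_) (Inverse.inverseˡ columns refl))
    (λ (x , j , u , w) → cong (λ (x , j , u) → x , j , u , w) (Inverse.inverseʳ columns refl))

  permuteRows : (Fin n × Fin r) ↔ (Fin n × Fin r)
  permuteRows = mk↔ₛ′
    (λ (w , c) → w , (row A w ⟨$⟩ʳ c))
    (λ (w , c) → w , (row A w ⟨$⟩ˡ c))
    (λ (w , c) → cong (w ,_) (Perm.inverseʳ (row A w)))
    (λ (w , c) → cong (w ,_) (Perm.inverseˡ (row A w)))

  size : ∀ g b q n → n * (g * (b * q)) ≡ g * (b * (q * n))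
  size = solve-∀

  labelling : Vertex (G ⊚ (b · H n q)) ↔ Fin (order (G ⊚ (b · H n q)))
  -- The inverse of `*↔×` is `combine`, which sends `(w , d)` to the number r w + d.
  labelling = ↔-trans cells (↔-trans permuteRows (↔-trans (↔-sym Fin.*↔×) (cast-id (size (order G) b q n))))

  block : ∀ x j u → _
  block x j u = begin
    ∑[ w < n ] suc (toℕ (Inverse.to labelling (x , j , u , w)))
      ≡⟨ sum-cong-≗ (λ w → cong suc (trans (Fin.toℕ-cast _ (combine w (row A w ⟨$⟩ʳ c))) (Fin.toℕ-combine w (row A w ⟨$⟩ʳ c)))) ⟩
    ∑[ w < n ] (suc (r * toℕ w) + toℕ (row A w ⟨$⟩ʳ c))
      ≡⟨ ∑-distrib-+ {n} (λ w → suc (r * toℕ w)) (λ w → toℕ (row A w ⟨$⟩ʳ c)) ⟩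
    ∑[ w < n ] suc (r * toℕ w) + ∑[ w < n ] toℕ (row A w ⟨$⟩ʳ c)
      ≡⟨ cong (_ +_) (column-sum A c) ⟩
    ∑[ w < n ] suc (r * toℕ w) + constant A ∎
    where c = Inverse.to columns (x , j , u)

-- Enumeration followed by labelling permutes `Fin (order G)`, so the labels sum to a triangular
-- number.
∑ᵛ-label : ∀ G f → 2 * ∑ᵛ G (label G f) ≡ order G * suc (order G)
∑ᵛ-label G f = trans
  (cong (2 *_) (sym (∑-permute (suc ∘ toℕ) (↔-trans (enumeration G) (⤖⇒↔ f)))))
  (2*sum-suc∘toℕ (order G))

∑ᵛ-uniform-blocks : ∀ b n q (φ : Fin b × Fin q × Fin n → ℕ) {c} → (∀ j u → ∑[ w < n ] φ (j , u , w) ≡ c) →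
  ∑ᵛ (b · H n q) φ ≡ b * (q * c)
∑ᵛ-uniform-blocks b n q φ uniform = trans (∑ᵛ-· b (H n q) φ)
  (sum-uniform λ j → trans (∑ᵛ-H n q (λ y → φ (j , y))) (sum-uniform (uniform j)))

-- Positivity of the three factors allows cancelling `r` in the count of all labels. The prime 2
-- then divides `n` or `suc N`, and in the latter case `N` is odd.
equalBlockSums⇒parity : ∀ G b n q → order G > 0 → b > 0 → q > 0 → EqualBlockSums G b n q →
  n % 2 ≡ 0 ⊎ order (G ⊚ (b · H n q)) % 2 ≡ 1
equalBlockSums⇒parity G b n q g>0 b>0 q>0 (f , c , uniform) =
  Sum.map (n∣m⇒m%n≡0 n 2) (%-pred-≡0 {N} ∘ n∣m⇒m%n≡0 (suc N) 2) (euclidsLemma n (suc N) prime[2] (divides c (trans n*suc-N≡2*c (*-comm 2 c))))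
  where
  N r : ℕ
  N = order (G ⊚ (b · H n q))
  r = order G * (b * q)

  instance
    r≢0 : NonZero r
    r≢0 = m*n≢0 (order G) (b * q) {{>-nonZero g>0}} {{m*n≢0 b q {{>-nonZero b>0}} {{>-nonZero q>0}}}}

  regroup : ∀ g b q n s → g * (b * q) * (n * s) ≡ g * (b * (q * n)) * s
  regroup = solve-∀
  regroup′ : ∀ g b q c → 2 * (g * (b * (q * c))) ≡ g * (b * q) * (2 * c)
  regroup′ = solve-∀

  n*suc-N≡2*c : n * suc N ≡ 2 * c
  n*suc-N≡2*c = *-cancelˡ-≡ (n * suc N) (2 * c) r (begin
    r * (n * suc N)                                     ≡⟨ regroup (order G) b q n (suc N) ⟩
    N * suc N                                           ≡⟨ ∑ᵛ-label (G ⊚ (b · H n q)) f ⟨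
    2 * ∑ᵛ (G ⊚ (b · H n q)) (label (G ⊚ (b · H n q)) f) ≡⟨ cong (2 *_) (∑ᵛ-⊚ G (b · H n q) (label (G ⊚ (b · H n q)) f)) ⟩
    2 * ∑ᵛ G (λ x → ∑ᵛ (b · H n q) (λ y → label (G ⊚ (b · H n q)) f (x , y)))
      ≡⟨ cong (2 *_) (sum-uniform {order G} λ i → ∑ᵛ-uniform-blocks b n q _ (uniform (Inverse.to (enumeration G) i))) ⟩
    2 * (order G * (b * (q * c)))                       ≡⟨ regroup′ (order G) b q c ⟩
    r * (2 * c)                                         ∎)

-- Parity and the existence of Kotzig arrays

even⊎odd : ∀ n → n % 2 ≡ 0 ⊎ n % 2 ≡ 1
even⊎odd n with n % 2 | m%n<n n 2
... | 0 | _ = inj₁ refl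
... | 1 | _ = inj₂ refl
... | suc (suc _) | s≤s (s≤s ())

odd-factorˡ : ∀ m n → (m * n) % 2 ≡ 1 → m % 2 ≡ 1
odd-factorˡ m n mn-odd with even⊎odd m
... | inj₂ m-odd = m-odd
... | inj₁ m-even with () ← trans (sym mn-odd) (n∣m⇒m%n≡0 (m * n) 2 (∣m⇒∣m*n n (m%n≡0⇒n∣m m 2 m-even)))

evenKotzig : ∀ n r → n % 2 ≡ 0 → KotzigArray n r
evenKotzig n r n-even = subst (λ n → KotzigArray n r) (sym n≡) (addPairs (n / 2) empty)
  where
  n≡ : n ≡ n / 2 * 2 + 0
  n≡ = trans (m≡m%n+[m/n]*n n 2) (trans (cong (_+ n / 2 * 2) n-even) (sym (+-identityʳ _)))

-- An odd `n` above 1 is 3 plus an even number: start from the three special rows and add pairs.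
oddKotzig : ∀ n r → n > 1 → n % 2 ≡ 1 → r % 2 ≡ 1 → KotzigArray n r
oddKotzig n r n>1 n-odd r-odd with n / 2 | m≡m%n+[m/n]*n n 2
-- Here `n` would be 1.
... | zero  | n≡ = contradiction (≤-reflexive (trans n≡ (cong (_+ 0) n-odd))) (<⇒≱ n>1)
... | suc k | n≡ = subst (λ n → KotzigArray n r) (sym n≡k*2+3)
                     (subst (KotzigArray (k * 2 + 3)) (sym r≡) (addPairs k (ThreeRows.threeRows (r / 2))))
  where
  n≡k*2+3 : n ≡ k * 2 + 3
  n≡k*2+3 = trans n≡ (trans (cong (_+ suc k * 2) n-odd) (+-comm 3 (k * 2)))
  r≡ : r ≡ suc (2 * (r / 2))
  r≡ = trans (m≡m%n+[m/n]*n r 2) (cong₂ _+_ r-odd (*-comm (r / 2) 2))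

parity⇒equalBlockSums : ∀ G b n q → n > 1 → n % 2 ≡ 0 ⊎ order (G ⊚ (b · H n q)) % 2 ≡ 1 → EqualBlockSums G b n q
parity⇒equalBlockSums G b n q n>1 (inj₁ n-even) = kotzig⇒equalBlockSums G b n q (evenKotzig n _ n-even)
parity⇒equalBlockSums G b n q n>1 (inj₂ N-odd)  = kotzig⇒equalBlockSums G b n q
  (oddKotzig n r n>1
    (odd-factorˡ n r (trans (cong (_% 2) (regroup (order G) b q n)) N-odd))
    (odd-factorˡ r n (trans (cong (_% 2) (trans (*-comm r n) (regroup (order G) b q n))) N-odd)))
  where
  r : ℕ
  r = order G * (b * q)
  regroup : ∀ g b q n → n * (g * (b * q)) ≡ g * (b * (q * n))
  regroup = solve-∀

-- Magic labellings and block sums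

∑ᴺ-uniform : ∀ n p φ {c} → (∀ s → ∑[ t < n ] φ (s , t) ≡ c) → ∀ s t → ∑ᴺ (H n p) φ (s , t) ≡ p * c ∸ c
∑ᴺ-uniform n p φ {c} uniform s t = begin
  ∑ᴺ (H n p) φ (s , t)         ≡⟨ m+n∸n≡m _ c ⟨
  ∑ᴺ (H n p) φ (s , t) + c ∸ c ≡⟨ cong (_∸ c) (trans (cong₂ _+_ refl (sym (uniform s))) (trans (∑ᴺ-H n p φ s t) (sum-uniform uniform))) ⟩
  p * c ∸ c                    ∎

module Product (a b m n p q : ℕ) where

  G K : Graph
  G = a · H m p
  K = b · H n q

  -- The outer summand comes from whole fibres over other parts of copy `i` of `H m p`, the inner
  -- one from the other blocks in copy `j` of `H n q` within the same fibre.
  weight : ∀ φ i s t j u w → ∑ᴺ (G ⊚ K) φ ((i , s , t) , j , u , w) ≡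
    ∑ᴺ (H m p) (λ y → ∑ᵛ K (λ h → φ ((i , y) , h))) (s , t) + ∑ᴺ (H n q) (λ y → φ ((i , s , t) , j , y)) (u , w)
  weight φ i s t j u w = trans (∑ᴺ-⊚ G K φ (i , s , t) (j , u , w))
    (cong₂ _+_ (∑ᴺ-· a (H m p) (λ g → ∑ᵛ K (λ h → φ (g , h))) i (s , t)) (∑ᴺ-· b (H n q) (λ h → φ ((i , s , t) , h)) j (u , w)))

  -- Every vertex is adjacent to p - 1 parts of m b q blocks each and to q - 1 blocks of its own
  -- fibre, all of sum `c`.
  equalBlockSums⇒magic : EqualBlockSums G b n q → DistanceMagic (G ⊚ K)
  equalBlockSums⇒magic (f , c , uniform) = f , p * part ∸ part + (q * c ∸ c) , λ ((i , s , t) , j , u , w) → trans (weight φ i s t j u w)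
    (cong₂ _+_
      (∑ᴺ-uniform m p (λ y → ∑ᵛ K (λ h → φ ((i , y) , h))) (λ s → sum-uniform λ t → ∑ᵛ-uniform-blocks b n q _ (uniform (i , s , t))) s t)
      (∑ᴺ-uniform n q (λ y → φ ((i , s , t) , j , y)) (uniform (i , s , t) j) u w))
    where
    φ : Vertex (G ⊚ K) → ℕ
    φ = label (G ⊚ K) f
    part : ℕ
    part = m * (b * (q * c))

-- Parameters are shifted by successors so that `zero` indexes a representative everywhere, and so
-- that the number `suc q` of other blocks in a copy of `H` is visibly nonzero.
module ConstantWeight (a b m n p q : ℕ)
  (φ : Vertex ((suc a · H (suc m) (suc p)) ⊚ (suc b · H (suc n) (2 + q))) → ℕ) (k : ℕ)
  (constant-weight : ∀ x → ∑ᴺ ((suc a · H (suc m) (suc p)) ⊚ (suc b · H (suc n) (2 + q))) φ x ≡ k) where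

  open Product (suc a) (suc b) (suc m) (suc n) (suc p) (2 + q)

  B : Vertex G → Fin (suc b) → Fin (2 + q) → ℕ
  B = blockSum φ

  -- Vertices of one block have the same neighbours within the fibre, so position `zero` represents
  -- them all.
  inner : Vertex G → Fin (suc b) → Fin (2 + q) → ℕ
  inner g j u = ∑ᴺ (H (suc n) (2 + q)) (λ y → φ (g , j , y)) (u , zero)

  C : Vertex G → ℕ
  C g = ∑ᵛ K (λ h → φ (g , h))

  outer : Fin (suc a) → Fin (suc p) → Fin (suc m) → ℕ
  outer i s t = ∑ᴺ (H (suc m) (suc p)) (λ y → C (i , y)) (s , t)

  outer+inner : ∀ i s t j u → outer i s t + inner (i , s , t) j u ≡ k
  outer+inner i s t j u = trans (sym (weight φ i s t j u zero)) (constant-weight ((i , s , t) , j , u , zero))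

  inner+B : ∀ g j u → inner g j u + B g j u ≡ ∑[ v < 2 + q ] B g j v
  inner+B g j u = ∑ᴺ-H (suc n) (2 + q) (λ y → φ (g , j , y)) u zero

  -- Within one fibre the outer summand is the same for all vertices and cancels.
  inner-const : ∀ g j u j′ u′ → inner g j u ≡ inner g j′ u′
  inner-const (i , s , t) j u j′ u′ =
    +-cancelˡ-≡ (outer i s t) _ _ (trans (outer+inner i s t j u) (sym (outer+inner i s t j′ u′)))

  B-indep-u : ∀ g j u u′ → B g j u ≡ B g j u′
  B-indep-u g j u u′ = +-cancelˡ-≡ (inner g j u) _ _ (begin
    inner g j u + B g j u    ≡⟨ trans (inner+B g j u) (sym (inner+B g j u′)) ⟩
    inner g j u′ + B g j u′  ≡⟨ cong (_+ B g j u′) (inner-const g j u′ j u) ⟩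
    inner g j u + B g j u′   ∎)

  inner≡ : ∀ g j u → inner g j u ≡ suc q * B g j u
  inner≡ g j u = +-cancelʳ-≡ (B g j u) _ _ (begin
    inner g j u + B g j u       ≡⟨ inner+B g j u ⟩
    ∑[ v < 2 + q ] B g j v      ≡⟨ sum-uniform (λ v → B-indep-u g j v u) ⟩
    (2 + q) * B g j u           ≡⟨ +-comm (B g j u) _ ⟩
    suc q * B g j u + B g j u   ∎)

  β : Vertex G → ℕ
  β g = B g zero zero

  -- Different copies `j` are compared through `inner`, which is `suc q` times the block sum in each
  -- of them.
  B≡β : ∀ g j u → B g j u ≡ β g
  B≡β g j u = *-cancelˡ-≡ _ _ (suc q) (begin
    suc q * B g j u    ≡⟨ inner≡ g j u ⟨
    inner g j u        ≡⟨ inner-const g j u zero zero ⟩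
    inner g zero zero  ≡⟨ inner≡ g zero zero ⟩
    suc q * β g        ∎)

  C≡ : ∀ g → C g ≡ suc b * ((2 + q) * β g)
  C≡ g = ∑ᵛ-uniform-blocks (suc b) (suc n) (2 + q) (λ h → φ (g , h)) (B≡β g)

  outer+β : ∀ i s t → outer i s t + suc q * β (i , s , t) ≡ k
  outer+β i s t = trans (cong (outer i s t +_) (sym (inner≡ (i , s , t) zero zero))) (outer+inner i s t zero zero)

  copySum : Fin (suc a) → ℕ
  copySum i = ∑[ s < suc p ] ∑[ t < suc m ] C (i , s , t)

  outer+part : ∀ i s t → outer i s t + ∑[ t′ < suc m ] C (i , s , t′) ≡ copySum i
  outer+part i s t = ∑ᴺ-H (suc m) (suc p) (λ y → C (i , y)) s t

  outer-indep-t : ∀ i s t t′ → outer i s t ≡ outer i s t′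
  outer-indep-t i s t t′ = +-cancelʳ-≡ (∑[ t″ < suc m ] C (i , s , t″)) (outer i s t) (outer i s t′)
    (trans (outer+part i s t) (sym (outer+part i s t′)))

  γ : Fin (suc a) → Fin (suc p) → ℕ
  γ i s = β (i , s , zero)

  -- Vertices of one part of a copy of `H` have the same neighbours in `G`, so the outer summand
  -- cancels again.
  β≡γ : ∀ i s t → β (i , s , t) ≡ γ i s
  β≡γ i s t = *-cancelˡ-≡ _ _ (suc q) (+-cancelˡ-≡ (outer i s t) _ _ (begin
    outer i s t + suc q * β (i , s , t)  ≡⟨ trans (outer+β i s t) (sym (outer+β i s zero)) ⟩
    outer i s zero + suc q * γ i s       ≡⟨ cong (_+ suc q * γ i s) (outer-indep-t i s zero t) ⟩
    outer i s t + suc q * γ i s          ∎))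

  -- In unshifted parameters this is m b q - (q - 1). The leading `suc` makes it visibly nonzero for
  -- cancellation.
  excess : ℕ
  excess = suc ((b + m * suc b) * (2 + q))

  -- A part of a copy contains m b q blocks, more than the q − 1 blocks which a
  -- vertex of that part is adjacent to inside it.
  part≡ : ∀ i s → ∑[ t < suc m ] C (i , s , t) ≡ (suc q + excess) * γ i s
  part≡ i s = trans
    (sum-uniform λ t → trans (C≡ (i , s , t)) (cong (λ c → suc b * ((2 + q) * c)) (β≡γ i s t)))
    (regroup b m q (γ i s))
    where
    regroup : ∀ b m q c → suc m * (suc b * ((2 + q) * c)) ≡ (suc q + suc ((b + m * suc b) * (2 + q))) * c
    regroup = solve-∀

  -- The weight of a vertex misses exactly `excess` blocks of its copy, all in its own part.
  -- Restoring them gives a total that does not depend on `s`, so parts can be compared.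
  k+excess : ∀ i s → k + excess * γ i s ≡ copySum i
  k+excess i s = begin
    k + excess * γ i s                                 ≡⟨ cong (_+ excess * γ i s) (outer+β i s zero) ⟨
    outer i s zero + suc q * γ i s + excess * γ i s    ≡⟨ +-assoc (outer i s zero) _ _ ⟩
    outer i s zero + (suc q * γ i s + excess * γ i s)  ≡⟨ cong (outer i s zero +_) (*-distribʳ-+ (γ i s) (suc q) excess) ⟨
    outer i s zero + (suc q + excess) * γ i s          ≡⟨ cong (outer i s zero +_) (part≡ i s) ⟨
    outer i s zero + ∑[ t < suc m ] C (i , s , t)      ≡⟨ outer+part i s zero ⟩
    copySum i                                          ∎

  δ : Fin (suc a) → ℕ
  δ i = γ i zero

  γ≡δ : ∀ i s → γ i s ≡ δ i
  γ≡δ i s = *-cancelˡ-≡ _ _ excess (+-cancelˡ-≡ k _ _ (trans (k+excess i s) (sym (k+excess i zero))))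

  -- The coefficient counts the blocks adjacent to a vertex: `suc q` in its own part and all those
  -- in the `p` other parts. As it is positive, the shared `k` determines `δ i`, which links
  -- different copies `i`.
  k≡ : ∀ i → k ≡ suc (q + p * (suc q + excess)) * δ i
  k≡ i = +-cancelʳ-≡ (excess * δ i) _ _ (begin
    k + excess * δ i                      ≡⟨ k+excess i zero ⟩
    copySum i                             ≡⟨ sum-uniform (λ s → trans (part≡ i s) (cong ((suc q + excess) *_) (γ≡δ i s))) ⟩
    suc p * ((suc q + excess) * δ i)      ≡⟨ regroup p q excess (δ i) ⟩
    suc (q + p * (suc q + excess)) * δ i + excess * δ i ∎)
    where
    regroup : ∀ p q e d → suc p * ((suc q + e) * d) ≡ suc (q + p * (suc q + e)) * d + e * d
    regroup = solve-∀

  block-const : ∀ g j u → B g j u ≡ δ zero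
  block-const g@(i , s , t) j u = begin
    B g j u  ≡⟨ B≡β g j u ⟩
    β g      ≡⟨ β≡γ i s t ⟩
    γ i s    ≡⟨ γ≡δ i s ⟩
    δ i      ≡⟨ *-cancelˡ-≡ _ _ (suc (q + p * (suc q + excess))) (trans (sym (k≡ i)) (k≡ zero)) ⟩
    δ zero   ∎

magic⇒equalBlockSums : ∀ a b m n p q →
  DistanceMagic ((suc a · H (suc m) (suc p)) ⊚ (suc b · H (suc n) (2 + q))) →
  EqualBlockSums (suc a · H (suc m) (suc p)) (suc b) (suc n) (2 + q)
magic⇒equalBlockSums a b m n p q (f , k , magic) = f , _ , ConstantWeight.block-const a b m n p q _ k magic

theorem13 : (a b m n p q : ℕ) → a ≥ 1 → b ≥ 1 → m > 1 → n > 1 → p > 1 → q > 1 →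
    DistanceMagic ((a · H m p) ⊚ (b · H n q)) ⇔ (n % 2 ≡ 0 ⊎ (m * n * a * b * p * q) % 2 ≡ 1)
theorem13 a@(suc a-1) b@(suc b-1) m@(suc m-1) n@(suc n-1) p@(suc p-1) q@(suc (suc q-2)) _ _ _ n>1 _ (s≤s (s≤s _)) = mk⇔
  (Sum.map₂ (subst (λ N → N % 2 ≡ 1) (regroup a b m n p q))
    ∘ equalBlockSums⇒parity (a · H m p) b n q z<s z<s z<s
    ∘ magic⇒equalBlockSums a-1 b-1 m-1 n-1 p-1 q-2)
  (Product.equalBlockSums⇒magic a b m n p q
    ∘ parity⇒equalBlockSums (a · H m p) b n q n>1
    ∘ Sum.map₂ (subst (λ N → N % 2 ≡ 1) (sym (regroup a b m n p q))))
  where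
  regroup : ∀ a b m n p q → a * (p * m) * (b * (q * n)) ≡ m * n * a * b * p * q
  regroup = solve-∀
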